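{- Let $p\in\mathrm{AP}$. The class $\mathfrak{F}^t_{\mathsf{EF}p}=\{(\mathcal{K},T)\mid\mathcal{K},T\models\mathsf{EF}p\text{ under team semantics}\}$ is not definable in classical multiset semantics; that is, there is no CTL-formula $\psi$ with $\mathfrak{F}^t_{\mathsf{EF}p}=\mathfrak{F}^c_\psi$.
   Context: Let $\mathrm{AP}$ be a countably infinite set of atomic propositions. A Kripke structure $\mathcal{K}=(W,R,\eta)$ has a finite set $W$ of worlds, a left-total relation $R\subseteq W\times W$ and a labeling $\eta\colon W\to2^{\mathrm{AP}}$ with each $\eta(w)$ finite. $\Pi(w)$ is the set of infinite $R$-paths $\pi$ with $\pi(0)=w$. CTL-formulae: $\varphi ::= p\mid\neg p\mid\varphi\land\varphi\mid\varphi\lor\varphi\mid\mathsf{P}\mathsf{X}\varphi\mid\mathsf{P}[\varphi\mathsf{U}\varphi]\mid\mathsf{P}[\varphi\mathsf{R}\varphi]$, $\mathsf{P}\in\{\mathsf{A},\mathsf{E}\}$, $p\in\mathrm{AP}$; $\top:=p\lor\neg p$, $\mathsf{EF}\varphi:=\mathsf{E}[\top\mathsf{U}\varphi]$. Classical satisfaction $\mathcal{K},w\models\varphi$ at a world is the usual CTL semantics. A multiset is a functional set of pairs $(i,x)$ with indices $i$ from a sufficiently large index set $\mathbb{I}$; a team of $\mathcal{K}$ is a multiset of worlds of $\mathcal{K}$ (we write $w\in T$ for $(i,w)\in T$). A map $f$ with domain $T$ is $T$-compatible if $f((i,x))\in\Pi(x)$ for all $(i,x)\in T$; then $T[f,n]=\{(i,f((i,x))(n))\mid(i,x)\in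 T\}$. Team semantics (TeamCTL): - $\mathcal{K},T\models p$ (resp. $\neg p$) iff $p\in\eta(w)$ (resp. $p\notin\eta(w)$) for all $w\in T$. - $\mathcal{K},T\models\varphi\land\psi$ iff $\mathcal{K},T\models\varphi$ and $\mathcal{K},T\models\psi$. - $\mathcal{K},T\models\varphi\lor\psi$ iff there are $T_1\cup T_2=T$, $T_1\cap T_2=\emptyset$, with $\mathcal{K},T_1\models\varphi$ and $\mathcal{K},T_2\models\psi$. - $\mathcal{K},T\models\mathsf{EX}\varphi$ (resp. $\mathsf{AX}\varphi$) iff for some (resp. every) $T$-compatible $f$: $\mathcal{K},T[f,1]\models\varphi$. - $\mathcal{K},T\models\mathsf{E}[\varphi\mathsf{U}\psi]$ (resp. $\mathsf{A}[\varphi\mathsf{U}\psi]$) iff for some (resp. every) $T$-compatible $f$ there is $k\in\mathbb{N}$ with $\mathcal{K},T[f,k]\models\psi$ and $\mathcal{K},T[f,k']\models\varphi$ for all $k'<k$. - $\mathcal{K},T\models\mathsf{E}[\varphi\mathsf{R}\psi]$ (resp. $\mathsf{A}[\varphi\mathsf{R}\psi]$) iff for some (resp. every) $T$-compatible $f$ and all $k\in\mathbb{N}$: $\mathcal{K},T[f,k]\models\psi$ or $\mathcal{K},T[f,k']\models\varphi$ for some $k'<k$. Classical multiset semantics: $\mathcal{K},T\models^c\varphi$ iff $\mathcal{K},w\models\varphi$ (classically) for all $w\in T$. $\mathfrak{F}^c_\varphi=\{(\mathcal{K},T)\mid\mathcal{K},T\models^c\varphi\}$, and a class $\mathfrak{F}$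 of pairs is definable in classical multiset semantics if $\mathfrak{F}=\mathfrak{F}^c_\psi$ for some formula $\psi$. -}

module Defs where

open import Data.Fin using (Fin)
open import Data.List using (List)
import Data.List.Membership.Propositional as List
open import Data.Nat using (ℕ; suc; _<_)
open import Data.Product using (Σ; ∃; _×_; _,_)
open import Data.Sum using (_⊎_)
open import Function.Bundles using (_↔_)
open import Level using (0ℓ; Lift; _⊔_) renaming (suc to ℓsuc)
open import Relation.Binary using (Rel)
open import Relation.Binary.PropositionalEquality using (_≡_; refl)
open import Relation.Unary using (Pred; _∈_; _∉_; _≐_; _∪_; _⊥_)

record Kripke (AP : Set) : Set₁ where
  field
    World      : Set
    finite     : ∃ λ n → World ↔ Fin n
    R          : Rel World 0ℓ
    left-total : ∀ w → ∃ λ v → R w v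
    η          : World → Pred AP 0ℓ
    η-finite   : ∀ w → Σ (List AP) λ ps → η w ≐ (List._∈ ps)

  Π : World → Pred (ℕ → World) 0ℓ
  Π w π = π 0 ≡ w × (∀ n → R (π n) (π (suc n)))

infixr 6 _∧_
infixr 5 _∨_

data CTL (AP : Set) : Set where
  atom ¬atom  : AP → CTL AP
  _∧_ _∨_     : CTL AP → CTL AP → CTL AP
  AX EX       : CTL AP → CTL AP
  A[_U_] E[_U_] A[_R_] E[_R_] : CTL AP → CTL AP → CTL AP

-- The syntax has no constant ⊤, so it is built from a chosen proposition;
-- EF takes that proposition as its first argument.
⊤ᶠ : {AP : Set} → AP → CTL AP
⊤ᶠ p = atom p ∨ ¬atom p

EF : {AP : Set} → AP → CTL AP → CTL AP
EF p φ = E[ ⊤ᶠ p U φ ]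

module Classical {AP : Set} (K : Kripke AP) where
  open Kripke K

  infix 4 _⊨_

  _⊨_ : World → CTL AP → Set
  w ⊨ atom p     = p ∈ η w
  w ⊨ ¬atom p    = p ∉ η w
  w ⊨ φ ∧ ψ      = w ⊨ φ × w ⊨ ψ
  w ⊨ φ ∨ ψ      = w ⊨ φ ⊎ w ⊨ ψ
  w ⊨ AX φ       = ∀ π → π ∈ Π w → π 1 ⊨ φ
  w ⊨ EX φ       = ∃ λ π → π ∈ Π w × π 1 ⊨ φ
  w ⊨ A[ φ U ψ ] = ∀ π → π ∈ Π w →
    ∃ λ k → π k ⊨ ψ × (∀ k′ → k′ < k → π k′ ⊨ φ)
  w ⊨ E[ φ U ψ ] = ∃ λ π → π ∈ Π w ×
    (∃ λ k → π k ⊨ ψ × (∀ k′ → k′ < k → π k′ ⊨ φ))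
  w ⊨ A[ φ R ψ ] = ∀ π → π ∈ Π w →
    ∀ k → π k ⊨ ψ ⊎ (∃ λ k′ → k′ < k × π k′ ⊨ φ)
  w ⊨ E[ φ R ψ ] = ∃ λ π → π ∈ Π w ×
    (∀ k → π k ⊨ ψ ⊎ (∃ λ k′ → k′ < k × π k′ ⊨ φ))

record Multiset (𝕀 X : Set) : Set₁ where
  field
    elems      : Pred (𝕀 × X) 0ℓ
    functional : ∀ {i x y} → (i , x) ∈ elems → (i , y) ∈ elems → x ≡ y

open Multiset public

Team : {AP : Set} → Set → Kripke AP → Set₁
Team 𝕀 K = Multiset 𝕀 (Kripke.World K)

module TeamSemantics {AP : Set} (𝕀 : Set) (K : Kripke AP) where
  open Kripke K

  -- The membership proof is irrelevant, so that f is a map on the set of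
  -- pairs (i , x) in T: its value cannot depend on how membership is proved.
  record Compatible (T : Team 𝕀 K) : Set where
    field
      path   : ∀ i x → .((i , x) ∈ elems T) → ℕ → World
      path∈Π : ∀ i x (m : (i , x) ∈ elems T) → path i x m ∈ Π x

  open Compatible public

  _⟨_,_⟩ : (T : Team 𝕀 K) → Compatible T → ℕ → Team 𝕀 K
  elems (T ⟨ f , n ⟩) (i , y) =
    ∃ λ x → Σ ((i , x) ∈ elems T) λ m → y ≡ path f i x m n
  functional (T ⟨ f , n ⟩) (x , m , refl) (x′ , m′ , refl)
    with functional T m m′
  ... | refl = refl

  infix 4 _⊨_

  _⊨_ : Team 𝕀 K → CTL AP → Set₁
  T ⊨ atom p     = Lift (ℓsuc 0ℓ) (∀ i w → (i , w) ∈ elems T → p ∈ η w)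
  T ⊨ ¬atom p    = Lift (ℓsuc 0ℓ) (∀ i w → (i , w) ∈ elems T → p ∉ η w)
  T ⊨ φ ∧ ψ      = T ⊨ φ × T ⊨ ψ
  T ⊨ φ ∨ ψ      = ∃ λ T₁ → ∃ λ T₂ →
    elems T₁ ∪ elems T₂ ≐ elems T × elems T₁ ⊥ elems T₂ × T₁ ⊨ φ × T₂ ⊨ ψ
  T ⊨ AX φ       = (f : Compatible T) → T ⟨ f , 1 ⟩ ⊨ φ
  T ⊨ EX φ       = Σ (Compatible T) λ f → T ⟨ f , 1 ⟩ ⊨ φ
  T ⊨ A[ φ U ψ ] = (f : Compatible T) →
    ∃ λ k → T ⟨ f , k ⟩ ⊨ ψ × (∀ k′ → k′ < k → T ⟨ f , k′ ⟩ ⊨ φ)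
  T ⊨ E[ φ U ψ ] = Σ (Compatible T) λ f →
    ∃ λ k → T ⟨ f , k ⟩ ⊨ ψ × (∀ k′ → k′ < k → T ⟨ f , k′ ⟩ ⊨ φ)
  T ⊨ A[ φ R ψ ] = (f : Compatible T) →
    ∀ k → T ⟨ f , k ⟩ ⊨ ψ ⊎ (∃ λ k′ → k′ < k × T ⟨ f , k′ ⟩ ⊨ φ)
  T ⊨ E[ φ R ψ ] = Σ (Compatible T) λ f →
    ∀ k → T ⟨ f , k ⟩ ⊨ ψ ⊎ (∃ λ k′ → k′ < k × T ⟨ f , k′ ⟩ ⊨ φ)

  infix 4 _⊨ᶜ_

  _⊨ᶜ_ : Team 𝕀 K → CTL AP → Set
  T ⊨ᶜ φ = ∀ i w → (i , w) ∈ elems T → Classical._⊨_ K w φ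

KripkeTeam : Set → Set → Set₁
KripkeTeam AP 𝕀 = Σ (Kripke AP) (Team 𝕀)

𝔉ᵗ : {AP 𝕀 : Set} → CTL AP → Pred (KripkeTeam AP 𝕀) (ℓsuc 0ℓ)
𝔉ᵗ {𝕀 = 𝕀} φ (K , T) = TeamSemantics._⊨_ 𝕀 K T φ

𝔉ᶜ : {AP 𝕀 : Set} → CTL AP → Pred (KripkeTeam AP 𝕀) 0ℓ
𝔉ᶜ {𝕀 = 𝕀} φ (K , T) = TeamSemantics._⊨ᶜ_ 𝕀 K T φ

Definableᶜ : ∀ {ℓ} {AP 𝕀 : Set} → Pred (KripkeTeam AP 𝕀) ℓ → Set (ℓsuc 0ℓ ⊔ ℓ)
Definableᶜ {AP = AP} 𝔉 = Σ (CTL AP) λ ψ → 𝔉 ≐ 𝔉ᶜ ψ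

{-# OPTIONS --safe #-}

-- Classical multiset semantics is closed under unions of teams, since it
-- looks at one world at a time.  In team semantics EF p asks for a single
-- moment at which p holds on all the chosen paths.  On 2 → 1 → 0 → 0 with p
-- true only at 1, singleton teams at 1 and at 2 satisfy EF p, but only at the
-- moments 0 and 1 respectively, so the union of two such teams does not.
module Submission where

open import Defs
open import Data.Empty using (⊥-elim)
open import Data.Fin using (Fin; pred)
open import Data.Fin.Patterns using (0F; 1F; 2F)
open import Data.List using ([]; _∷_)
open import Data.List.Relation.Unary.Any using (here)
open import Data.Nat using (ℕ; zero; suc; s≤s)
open import Data.Nat.GeneralisedArithmetic using (fold)
open import Data.Product using (_,_; proj₁; proj₂)
open import Data.Sum using (inj₁; inj₂; [_,_])
open import Function using (id)
open import Function.Bundles using (_↔_; _↣_; module Injection)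
open import Function.Construct.Identity using (↔-id)
open import Level using (lift; lower)
open import Relation.Binary.PropositionalEquality
  using (_≡_; _≢_; refl; sym; trans; cong; subst)
open import Relation.Nullary using (¬_)
open import Relation.Unary using (Pred; _∈_; _∉_; _∪_; ∅; ｛_｝)

emptyMultiset : {I X : Set} → Multiset I X
elems      emptyMultiset = ∅
functional emptyMultiset ()

singleton : {I X : Set} → I → X → Multiset I X
elems      (singleton i x) = ｛ i , x ｝
functional (singleton i x) refl refl = refl

-- Distinct indices keep the set functional even when the two worlds differ.
doubleton : {I X : Set} (i j : I) → i ≢ j → X → X → Multiset I X
elems      (doubleton i j i≢j x y) = ｛ i , x ｝ ∪ ｛ j , y ｝
functional (doubleton i j i≢j x y) (inj₁ refl) (inj₁ refl) = refl
functional (doubleton i j i≢j x y) (inj₁ refl) (inj₂ refl) = ⊥-elim (i≢j refl)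
functional (doubleton i j i≢j x y) (inj₂ refl) (inj₁ refl) = ⊥-elim (i≢j refl)
functional (doubleton i j i≢j x y) (inj₂ refl) (inj₂ refl) = refl

-- The split puts the whole team on the right; the empty left part satisfies `atom p` vacuously.
¬atom⇒⊤ᶠ : {AP 𝕀 : Set} (K : Kripke AP) (T : Team 𝕀 K) (p : AP) →
           TeamSemantics._⊨_ 𝕀 K T (¬atom p) → TeamSemantics._⊨_ 𝕀 K T (⊤ᶠ p)
¬atom⇒⊤ᶠ K T p T⊨¬p =
  emptyMultiset , T , ([ (λ ()) , id ] , inj₂) , (λ ()) , lift (λ _ _ ()) , T⊨¬p

module Chain {AP : Set} (p : AP) where

  label : Fin 3 → Pred AP _
  label 0F = ∅
  label 1F = ｛ p ｝
  label 2F = ∅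

  chain : Kripke AP
  chain = record
    { World      = Fin 3
    ; finite     = 3 , ↔-id (Fin 3)
    -- `pred` fixes `0F`, so the chain ends in a loop and every world has exactly one successor.
    ; R          = λ w v → v ≡ pred w
    ; left-total = λ w → pred w , refl
    ; η          = label
    ; η-finite   = λ where
        0F → [] , (λ ()) , (λ ())
        1F → p ∷ [] , (λ { refl → here refl }) , (λ { (here refl) → refl })
        2F → [] , (λ ()) , (λ ())
    }

  open Kripke chain using (Π)

  -- One step leads from `1F` to the fixed point `0F` of `pred`. So a path from `1F` meets `p` at
  -- moment 0 only.
  stays-at-0 : ∀ π → π ∈ Π 1F → ∀ k → π (suc k) ≡ 0F
  stays-at-0 π (π0≡1 , step) zero    = trans (step 0) (cong pred π0≡1)
  stays-at-0 π π∈Π           (suc k) =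
    trans (proj₂ π∈Π (suc k)) (cong pred (stays-at-0 π π∈Π k))

  module _ {𝕀 : Set} where
    open TeamSemantics 𝕀 chain

    descend : (T : Team 𝕀 chain) → Compatible T
    path   (descend T) _ x _ = fold x pred
    path∈Π (descend T) _ _ _ = refl , λ _ → refl

    singleton-1⊨EF : ∀ i → singleton i 1F ⊨ EF p (atom p)
    singleton-1⊨EF i = descend _ , 0
      , lift (λ { _ _ (_ , refl , refl) → refl })
      , λ _ ()

    singleton-2⊨EF : ∀ i → singleton i 2F ⊨ EF p (atom p)
    singleton-2⊨EF i = descend T , 1
      , lift (λ { _ _ (_ , refl , refl) → refl })
      -- Moment 0 is the only earlier one; the team is then at `2F`, where `p` fails.
      , λ { zero _ → ¬atom⇒⊤ᶠ chain (T ⟨ descend T , 0 ⟩) p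
                       (lift λ { _ _ (_ , refl , refl) () })
          ; (suc _) (s≤s ()) }
      where T = singleton i 2F

    -- No moment suits both entries: at moment 0 entry `j` is still at `2F`, and from moment 1 on
    -- entry `i` is at `0F`; `p` fails at both worlds.
    doubleton⊭EF : ∀ {i j} (i≢j : i ≢ j) →
                   ¬ doubleton i j i≢j 1F 2F ⊨ EF p (atom p)
    doubleton⊭EF {j = j} _ (f , zero , ⊨p , _) =
      subst (λ w → p ∉ label w) (sym (proj₁ (path∈Π f j 2F m))) (λ ())
        (lower ⊨p j _ (2F , m , refl))
      where m = inj₂ refl
    doubleton⊭EF {i = i} _ (f , suc k , ⊨p , _) =
      subst (λ w → p ∉ label w) (sym π[1+k]≡0) (λ ())
        (lower ⊨p i _ (1F , m , refl))
      where
      m = inj₁ refl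
      π[1+k]≡0 = stays-at-0 (path f i 1F m) (path∈Π f i 1F m) k

theorem8p3 : (AP 𝕀 : Set) → AP ↔ ℕ → ℕ ↣ 𝕀 → (p : AP) → ¬ Definableᶜ {AP = AP} {𝕀 = 𝕀} (𝔉ᵗ (EF p (atom p)))
theorem8p3 AP 𝕀 _ ℕ↣𝕀 p (ψ , t⊆c , c⊆t) =
  -- The singletons yield `ψ` at `1F` and at `2F` classically, hence on the doubleton, and `c⊆t`
  -- turns this back into `EF p`.
  doubleton⊭EF i≢j (c⊆t {chain , doubleton i j i≢j 1F 2F} λ where
    _ _ (inj₁ refl) → t⊆c {chain , singleton i 1F} (singleton-1⊨EF i) i 1F refl
    _ _ (inj₂ refl) → t⊆c {chain , singleton j 2F} (singleton-2⊨EF j) j 2F refl)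
  where
  open Chain p
  open Injection ℕ↣𝕀 using (to; injective)

  i = to 0
  j = to 1

  i≢j : i ≢ j
  i≢j eq with () ← injective eq
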